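{- Let $m\ge1$, $h\ge 2$ and $t\geq 1$ be integers. Under the identification of a ruler $(x_0,\dots,x_m)$ with its vector of successive differences $\mathbf{z}=(z_1,\dots,z_m)$, $z_i=x_i-x_{i-1}$, the $B_h$-sets with $m+1$ markings and length $t$ are in bijection with the lattice points (points of $\mathbb{Z}^m$) in the interior of $t\Delta_{m-1}$ that are not contained in any nondegenerate hyperplane of the form $$\sum_{k=1}^{\ell}\Big(\sum_{j\in U_k}z_j\Big)=\sum_{k=\ell+1}^{h'}\Big(\sum_{j\in U_k}z_j\Big),$$ where $0\le\ell\le h'\le h$ and $U_1,\dots,U_{h'}$ are proper consecutive subsets of $[m]$.
   Context: A ruler of length $t$ with $m+1$ markings is a sequence of integers $0=x_0<x_1<\cdots<x_{m-1}<x_m=t$. It is a $B_h$-set if for every pair of distinct sequences $0\le r_1\le\cdots\le r_h\le m$ and $0\le s_1\le\cdots\le s_h\le m$ one has $x_{r_1}+\cdots+x_{r_h}\neq x_{s_1}+\cdots+x_{s_h}$. $[m]=\{1,\dots,m\}$, and $\Delta_{m-1}=\{\mathbf{z}\in\mathbb{R}^m: z_1,\dots,z_m\ge 0,\ \sum_{i=1}^m z_i=1\}$. The interior of $t\Delta_{m-1}$ means its relative interior, $\{\mathbf{z}: z_i>0 \text{ for all } i,\ \sum_i z_i=t\}$. A consecutive subset of $[m]$ is a nonempty set of the form $\{j,j+1,\dots,k\}$; it is proper if it is not equal to $[m]$. The sets $U_k$ need not be distinct; empty sums are $0$. A hyperplane of the displayed form is nondegenerate if its equation is not identically satisfied on $\mathbb{R}^m$.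 -}

module Defs where

open import Algebra.Bundles using (CommutativeMonoid; RawMonoid)
import Algebra.Definitions.RawMonoid as RawMonoidDefinitions
import Algebra.Properties.CommutativeSemigroup as CommutativeSemigroupProperties
open import Data.Bool.Base using (if_then_else_)
open import Data.Fin.Base using (Fin; zero; suc; fromℕ; inject₁; _↑ˡ_; _↑ʳ_)
  renaming (_≤_ to _≤ᶠ_)
open import Data.Fin.Subset using (Subset; ⊤; _∈_)
open import Data.Integer.Base as ℤ using (ℤ; +_; 0ℤ)
open import Data.Nat.Base as ℕ using (ℕ; suc)
import Data.Nat.Properties as ℕ
open import Data.Product.Base using (Σ-syntax; ∃-syntax; _×_; _,_; proj₁; proj₂)
open import Data.Rational.Base as ℚ using (ℚ; 0ℚ; ½)
import Data.Rational.Properties as ℚ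
open import Data.Vec.Base using (lookup)
open import Data.Vec.Functional using (Vector; map)
open import Function.Base using (_∘_)
open import Function.Bundles using (_⇔_)
open import Level using (0ℓ)
open import Relation.Binary.Bundles using (Setoid)
import Relation.Binary.Construct.On as On
open import Relation.Binary.Definitions using (Monotonic₁)
open import Relation.Binary.PropositionalEquality
  using (_≡_; _≢_; _≗_; _→-setoid_; refl; sym; trans; cong; subst)
open import Relation.Nullary.Negation using (¬_)

------------------------------------------------------------------------
-- Real numbers: Cauchy sequences of rationals, compared up to _≃_.

record ℝ : Set where
  field
    seq    : ℕ → ℚ
    cauchy : ∀ ε → 0ℚ ℚ.< ε →
             ∃[ N ] ∀ i j → N ℕ.≤ i → N ℕ.≤ j → ℚ.∣ seq i ℚ.- seq j ∣ ℚ.< ε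

open ℝ public

infix 4 _≃_ _<ᴿ_

_≃_ : ℝ → ℝ → Set
x ≃ y = ∀ ε → 0ℚ ℚ.< ε →
        ∃[ N ] ∀ i → N ℕ.≤ i → ℚ.∣ seq x i ℚ.- seq y i ∣ ℚ.< ε

_<ᴿ_ : ℝ → ℝ → Set
x <ᴿ y = ∃[ ε ] 0ℚ ℚ.< ε ×
         (∃[ N ] ∀ i → N ℕ.≤ i → seq x i ℚ.+ ε ℚ.≤ seq y i)

fromℚ : ℚ → ℝ
fromℚ q .seq _ = q
fromℚ q .cauchy ε 0<ε =
  0 , λ _ _ _ _ → subst (λ d → ℚ.∣ d ∣ ℚ.< ε) (sym (ℚ.+-inverseʳ q)) 0<ε

fromℤ : ℤ → ℝ
fromℤ z = fromℚ (z ℚ./ 1)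

0ᴿ : ℝ
0ᴿ = fromℤ 0ℤ

infixl 6 _+ᴿ_

_+ᴿ_ : ℝ → ℝ → ℝ
(x +ᴿ y) .seq i = seq x i ℚ.+ seq y i
(x +ᴿ y) .cauchy ε 0<ε = M ℕ.⊔ N , close
  where
  open CommutativeSemigroupProperties
    (CommutativeMonoid.commutativeSemigroup ℚ.+-0-commutativeMonoid)
    using (interchange)

  0<½ε : 0ℚ ℚ.< ½ ℚ.* ε
  0<½ε = subst (ℚ._< ½ ℚ.* ε) (ℚ.*-zeroʳ ½) (ℚ.*-monoʳ-<-pos ½ 0<ε)

  halves : ½ ℚ.* ε ℚ.+ ½ ℚ.* ε ≡ ε
  halves = trans (sym (ℚ.*-distribʳ-+ ε ½ ½)) (ℚ.*-identityˡ ε)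

  M N : ℕ
  M = proj₁ (cauchy x (½ ℚ.* ε) 0<½ε)
  N = proj₁ (cauchy y (½ ℚ.* ε) 0<½ε)

  regroup : ∀ a b c d →
            (a ℚ.+ b) ℚ.- (c ℚ.+ d) ≡ (a ℚ.- c) ℚ.+ (b ℚ.- d)
  regroup a b c d = trans (cong ((a ℚ.+ b) ℚ.+_) (ℚ.neg-distrib-+ c d))
                          (interchange a b (ℚ.- c) (ℚ.- d))

  close : ∀ i j → M ℕ.⊔ N ℕ.≤ i → M ℕ.⊔ N ℕ.≤ j →
          ℚ.∣ (seq x i ℚ.+ seq y i) ℚ.- (seq x j ℚ.+ seq y j) ∣ ℚ.< ε
  close i j ≤i ≤j = begin-strict
    ℚ.∣ (seq x i ℚ.+ seq y i) ℚ.- (seq x j ℚ.+ seq y j) ∣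
      ≡⟨ cong ℚ.∣_∣ (regroup (seq x i) (seq y i) (seq x j) (seq y j)) ⟩
    ℚ.∣ (seq x i ℚ.- seq x j) ℚ.+ (seq y i ℚ.- seq y j) ∣
      ≤⟨ ℚ.∣p+q∣≤∣p∣+∣q∣ (seq x i ℚ.- seq x j) (seq y i ℚ.- seq y j) ⟩
    ℚ.∣ seq x i ℚ.- seq x j ∣ ℚ.+ ℚ.∣ seq y i ℚ.- seq y j ∣
      <⟨ ℚ.+-mono-< (closeˣ i j (left ≤i) (left ≤j))
                    (closeʸ i j (right ≤i) (right ≤j)) ⟩
    ½ ℚ.* ε ℚ.+ ½ ℚ.* ε
      ≡⟨ halves ⟩
    ε ∎
    where
    open ℚ.≤-Reasoning
    closeˣ = proj₂ (cauchy x (½ ℚ.* ε) 0<½ε)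
    closeʸ = proj₂ (cauchy y (½ ℚ.* ε) 0<½ε)
    left : ∀ {k} → M ℕ.⊔ N ℕ.≤ k → M ℕ.≤ k
    left = ℕ.m⊔n≤o⇒m≤o M N
    right : ∀ {k} → M ℕ.⊔ N ℕ.≤ k → N ℕ.≤ k
    right = ℕ.m⊔n≤o⇒n≤o M N

+ᴿ-rawMonoid : RawMonoid 0ℓ 0ℓ
+ᴿ-rawMonoid = record { _≈_ = _≃_ ; _∙_ = _+ᴿ_ ; ε = 0ᴿ }

open RawMonoidDefinitions ℤ.+-0-rawMonoid public using () renaming (sum to sumℤ)
open RawMonoidDefinitions +ᴿ-rawMonoid public using () renaming (sum to sumᴿ)

------------------------------------------------------------------------
-- Rulers and B_h-sets

record IsRuler {m : ℕ} (t : ℕ) (x : Vector ℤ (suc m)) : Set where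
  field
    starts     : x zero ≡ 0ℤ
    increasing : ∀ (i : Fin m) → x (inject₁ i) ℤ.< x (suc i)
    ends       : x (fromℕ m) ≡ + t

IsBₕSet : ∀ {m} (h : ℕ) → Vector ℤ (suc m) → Set
IsBₕSet {m} h x = (r s : Vector (Fin (suc m)) h) →
  Monotonic₁ _≤ᶠ_ _≤ᶠ_ r → Monotonic₁ _≤ᶠ_ _≤ᶠ_ s → ¬ (r ≗ s) →
  sumℤ (x ∘ r) ≢ sumℤ (x ∘ s)

differences : ∀ {m} → Vector ℤ (suc m) → Vector ℤ m
differences x i = x (suc i) ℤ.- x (inject₁ i)

------------------------------------------------------------------------
-- Simplices and hyperplanes. Elements of [m] = {1,…,m} are represented by
-- Fin m, shifted down by one.

InteriorOfDilatedSimplex : ∀ {m} → ℝ → Vector ℝ m → Set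
InteriorOfDilatedSimplex t z = (∀ i → 0ᴿ <ᴿ z i) × sumᴿ z ≃ t

Consecutive : ∀ {m} → Subset m → Set
Consecutive {m} U =
  Σ[ j ∈ Fin m ] Σ[ k ∈ Fin m ]
    j ≤ᶠ k × (∀ i → i ∈ U ⇔ (j ≤ᶠ i × i ≤ᶠ k))

sumOver : ∀ {m} → Subset m → Vector ℝ m → ℝ
sumOver U z = sumᴿ (λ j → if lookup U j then z j else 0ᴿ)

-- The number of sets is h' = ℓ + n: the first ℓ of them form the left-hand
-- side and the remaining n the right-hand side.
record IntervalEquation (m h : ℕ) : Set where
  field
    ℓ n         : ℕ
    h'≤h        : ℓ ℕ.+ n ℕ.≤ h
    U           : Vector (Subset m) (ℓ ℕ.+ n)
    consecutive : ∀ k → Consecutive (U k)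
    proper      : ∀ k → U k ≢ ⊤

module _ {m h : ℕ} (E : IntervalEquation m h) where
  open IntervalEquation E

  Satisfies : Vector ℝ m → Set
  Satisfies z = sumᴿ (λ (k : Fin ℓ) → sumOver (U (k ↑ˡ n)) z)
              ≃ sumᴿ (λ (k : Fin n) → sumOver (U (ℓ ↑ʳ k)) z)

  Nondegenerate : Set
  Nondegenerate = ¬ (∀ z → Satisfies z)

------------------------------------------------------------------------
-- The two sets in bijection. Equality ignores the proof components and is
-- pointwise on the underlying sequence.

BₕRuler : (m h t : ℕ) → Set
BₕRuler m h t = Σ[ x ∈ Vector ℤ (suc m) ] IsRuler t x × IsBₕSet h x

AvoidingLatticePoint : (m h t : ℕ) → Set
AvoidingLatticePoint m h t = Σ[ z ∈ Vector ℤ m ]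
  InteriorOfDilatedSimplex (fromℤ (+ t)) (map fromℤ z) ×
  ((E : IntervalEquation m h) → Nondegenerate E → ¬ Satisfies E (map fromℤ z))

BₕRulers : (m h t : ℕ) → Setoid 0ℓ 0ℓ
BₕRulers m h t = On.setoid {B = BₕRuler m h t} (Fin (suc m) →-setoid ℤ) proj₁

AvoidingLatticePoints : (m h t : ℕ) → Setoid 0ℓ 0ℓ
AvoidingLatticePoints m h t =
  On.setoid {B = AvoidingLatticePoint m h t} (Fin m →-setoid ℤ) proj₁

{-# OPTIONS --safe #-}

-- Write x for the ruler with differences z, so that the sum of z over
-- {j,…,k} is x_k − x_{j−1}. Moving the negative terms to the other side, an
-- interval equation becomes an equality x_{p₁} + ⋯ = x_{q₁} + ⋯ between sums
-- of markings, padded to h terms with copies of x₀ and then sorted. If the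
-- sorted index sequences agree the equation is an identity, and otherwise the
-- B_h property forbids it.
-- Conversely, from sorted r ≠ s with equal sums, the pairs (r_k, s_k) with
-- r_k ≠ s_k bound the intervals of an equation satisfied by z. None of them is
-- [m]: r_k = 0 and s_k = m would force r ≤ s pointwise, strictly at k. The
-- equation is nondegenerate because it fails when x is the indicator of
-- {i ≥ s_k} for some k with r_k < s_k (after exchanging r and s if needed).

module Submission where

open import Defs
open import Data.Nat.Base using (ℕ; _≤_)
open import Data.Product.Base using (Σ-syntax; proj₁)
open import Function.Bundles using (Bijection)
open import Relation.Binary.PropositionalEquality using (_≗_)

open import Algebra.Bundles using (AbelianGroup)
import Algebra.Properties.AbelianGroup as AbelianGroupProperties
import Algebra.Properties.CommutativeMonoid.Sum as Sum
open import Data.Bool.Base using (true; false; if_then_else_)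
open import Data.Bool.Properties using (¬-not)
open import Data.Fin.Base using (Fin; zero; suc; toℕ; fromℕ; inject₁; _↑ˡ_; _↑ʳ_)
  renaming (_≤_ to _≤ᶠ_; _<_ to _<ᶠ_)
open import Data.Fin.Induction using (<-weakInduction-startingFrom)
import Data.Fin.Properties as Fin
open import Data.Fin.Relation.Unary.Top using (view; ‵fromℕ; ‵inject₁)
open import Data.Fin.Subset using (Subset; ⊤; _∈_)
open import Data.Fin.Subset.Properties using (∈⊤)
open import Data.Integer.Base as ℤ using (ℤ; +_; 0ℤ)
import Data.Integer.Properties as ℤ
open import Data.Nat.Base as ℕ using (suc; zero; z≤n; s≤s)
import Data.Nat.Properties as ℕ
open import Data.Product.Base using (∃-syntax; _×_; _,_; proj₂)
open import Data.Rational.Base as ℚ using (ℚ; 0ℚ; 1ℚ)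
import Data.Rational.Properties as ℚ
open import Data.Rational.Solver using (module +-*-Solver)
import Data.Rational.Unnormalised.Base as ℚᵘ
import Data.Rational.Unnormalised.Properties as ℚᵘ
open import Data.Sum.Base using (inj₁; inj₂)
open import Data.Vec.Base using (lookup; tabulate)
open import Data.Vec.Functional using (Vector; map; _∷_; []; _++_; tail; replicate)
open import Data.Vec.Functional.Properties using (lookup-++ˡ; lookup-++ʳ)
open import Data.Vec.Properties using ([]=⇒lookup; lookup⇒[]=; lookup∘tabulate)
open import Function.Base using (_∘_; flip)
open import Function.Bundles using (_⇔_; mk⇔; Equivalence)
open import Relation.Binary.Definitions using (Monotonic₁; tri<; tri≈; tri>)
open import Relation.Binary.PropositionalEquality
  using (_≡_; _≢_; refl; sym; trans; cong; cong₂; subst; subst₂; module ≡-Reasoning)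
open import Relation.Nullary.Decidable
  using (Dec; does; yes; no; dec-true; dec-false; decidable-stable; _×-dec_)
open import Relation.Nullary.Negation using (¬_; contradiction)

open Sum ℚ.+-0-commutativeMonoid using ()
  renaming (sum to sumℚ; sum-cong-≗ to sumℚ-cong; ∑-distrib-+ to sumℚ-distrib-+)
open +-*-Solver using (solve; _:=_; _:+_; _:-_)

-- Differences and partial sums in an abelian group.

module Telescoping {c ℓ} (G : AbelianGroup c ℓ) where
  open AbelianGroup G renaming (refl to ≈-refl; sym to ≈-sym; trans to ≈-trans)
  open AbelianGroupProperties G using (⁻¹-∙-comm; ε⁻¹≈ε)
  open Sum commutativeMonoid using (sum; sum-replicate-zero)
  open import Algebra.Properties.CommutativeSemigroup commutativeSemigroup
    using (interchange)
  open import Relation.Binary.Reasoning.Setoid setoid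

  -- Over ℤ this unfolds to `differences`; over ℚ it is applied to rational test vectors and, one
  -- sequence index at a time, to real vectors.
  Δ : ∀ {n} → Vector Carrier (suc n) → Vector Carrier n
  Δ x i = x (suc i) ∙ x (inject₁ i) ⁻¹

  -- Written as a full sum under a mask so that `segment-sum` can add it entry by entry to the
  -- masked sum over a subset. The mask reduces at successor indices, so splitting off one entry
  -- leaves a partial sum of the tail.
  partialSum : ∀ {n} → Vector Carrier n → Vector Carrier (suc n)
  partialSum z i = sum (λ j → if does (toℕ j ℕ.<? toℕ i) then z j else ε)

  partialSum-zero : ∀ {n} (z : Vector Carrier n) → partialSum z zero ≈ ε
  partialSum-zero {n} z = sum-replicate-zero n

  partialSum-last : ∀ {n} (z : Vector Carrier n) → partialSum z (fromℕ n) ≈ sum z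
  partialSum-last {zero}  z = ≈-refl
  partialSum-last {suc n} z = ∙-congˡ (partialSum-last (tail z))

  Δ-partialSum : ∀ {n} (z : Vector Carrier n) i → Δ (partialSum z) i ≈ z i
  Δ-partialSum {suc n} z zero = begin
    (z zero ∙ partialSum (tail z) zero) ∙ partialSum z zero ⁻¹
      ≈⟨ ∙-cong (∙-congˡ (partialSum-zero (tail z))) (⁻¹-cong (partialSum-zero z)) ⟩
    (z zero ∙ ε) ∙ ε ⁻¹
      ≈⟨ ∙-cong (identityʳ _) ε⁻¹≈ε ⟩
    z zero ∙ ε
      ≈⟨ identityʳ _ ⟩
    z zero ∎
  Δ-partialSum {suc n} z (suc i) = begin
    (z zero ∙ s (suc i)) ∙ (z zero ∙ s (inject₁ i)) ⁻¹
      ≈⟨ ∙-congˡ (⁻¹-∙-comm _ _) ⟨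
    (z zero ∙ s (suc i)) ∙ (z zero ⁻¹ ∙ s (inject₁ i) ⁻¹)
      ≈⟨ interchange _ _ _ _ ⟩
    (z zero ∙ z zero ⁻¹) ∙ Δ s i
      ≈⟨ ∙-cong (inverseʳ _) (Δ-partialSum (tail z) i) ⟩
    ε ∙ z (suc i)
      ≈⟨ identityˡ _ ⟩
    z (suc i) ∎
    where s = partialSum (tail z)

  partialSum-Δ : ∀ {n} (x : Vector Carrier (suc n)) i →
                 partialSum (Δ x) i ≈ x i ∙ x zero ⁻¹
  partialSum-Δ x zero = ≈-trans (partialSum-zero (Δ x)) (≈-sym (inverseʳ _))
  partialSum-Δ {suc n} x (suc i) = begin
    Δ x zero ∙ partialSum (Δ (tail x)) i
      ≈⟨ ∙-congˡ (partialSum-Δ (tail x) i) ⟩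
    (x (suc zero) ∙ x zero ⁻¹) ∙ (x (suc i) ∙ x (suc zero) ⁻¹)
      ≈⟨ ∙-congˡ (comm _ _) ⟩
    (x (suc zero) ∙ x zero ⁻¹) ∙ (x (suc zero) ⁻¹ ∙ x (suc i))
      ≈⟨ interchange _ _ _ _ ⟩
    (x (suc zero) ∙ x (suc zero) ⁻¹) ∙ (x zero ⁻¹ ∙ x (suc i))
      ≈⟨ ∙-cong (inverseʳ _) (comm _ _) ⟩
    ε ∙ (x (suc i) ∙ x zero ⁻¹)
      ≈⟨ identityˡ _ ⟩
    x (suc i) ∙ x zero ⁻¹ ∎

  Δ-injective : ∀ {n} (x y : Vector Carrier (suc n)) →
                x zero ≈ y zero → (∀ i → Δ x i ≈ Δ y i) → ∀ i → x i ≈ y i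
  Δ-injective x y x₀≈y₀ Δx≈Δy zero = x₀≈y₀
  Δ-injective {suc n} x y x₀≈y₀ Δx≈Δy (suc i) =
    Δ-injective (tail x) (tail y) x₁≈y₁ (Δx≈Δy ∘ suc) i
    where
    x₁≈y₁ : x (suc zero) ≈ y (suc zero)
    x₁≈y₁ = AbelianGroupProperties.∙-cancelʳ G (x zero ⁻¹) _ _
      (≈-trans (Δx≈Δy zero) (∙-congˡ (⁻¹-cong (≈-sym x₀≈y₀))))

module Tℤ = Telescoping ℤ.+-0-abelianGroup
module Tℚ = Telescoping ℚ.+-0-abelianGroup
open Tℚ using (Δ; partialSum)

-- Integers as rationals

ι : ℤ → ℚ
ι a = a ℚ./ 1

toℚᵘ-ι : ∀ a → ℚ.toℚᵘ (ι a) ℚᵘ.≃ ℚᵘ.mkℚᵘ a 0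
toℚᵘ-ι a = ℚ.toℚᵘ-fromℚᵘ (ℚᵘ.mkℚᵘ a 0)

-- `ι` reduces to lowest terms, which does not compute on a variable, so the equation is checked on
-- unnormalised fractions. There `mkℚᵘ a 0` is a/1, denominators being stored less one.
ι-+ : ∀ a b → ι (a ℤ.+ b) ≡ ι a ℚ.+ ι b
ι-+ a b = ℚ.toℚᵘ-injective (begin
  ℚ.toℚᵘ (ι (a ℤ.+ b))               ≈⟨ toℚᵘ-ι (a ℤ.+ b) ⟩
  ℚᵘ.mkℚᵘ (a ℤ.+ b) 0                ≡⟨ cong₂ (λ c d → ℚᵘ.mkℚᵘ (c ℤ.+ d) 0) (ℤ.*-identityʳ a) (ℤ.*-identityʳ b) ⟨
  ℚᵘ.mkℚᵘ a 0 ℚᵘ.+ ℚᵘ.mkℚᵘ b 0       ≈⟨ ℚᵘ.+-cong (toℚᵘ-ι a) (toℚᵘ-ι b) ⟨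
  ℚ.toℚᵘ (ι a) ℚᵘ.+ ℚ.toℚᵘ (ι b)     ≈⟨ ℚ.toℚᵘ-homo-+ (ι a) (ι b) ⟨
  ℚ.toℚᵘ (ι a ℚ.+ ι b)               ∎)
  where open ℚᵘ.≃-Reasoning

ι-minus : ∀ a b → ι (a ℤ.- b) ≡ ι a ℚ.- ι b
ι-minus a b = begin
  ι (a ℤ.- b)                       ≡⟨ solve 2 (λ p q → p := p :+ q :- q) refl (ι (a ℤ.- b)) (ι b) ⟩
  ι (a ℤ.- b) ℚ.+ ι b ℚ.- ι b       ≡⟨ cong (ℚ._- ι b) (ι-+ (a ℤ.- b) b) ⟨
  ι (a ℤ.- b ℤ.+ b) ℚ.- ι b         ≡⟨ cong (λ c → ι c ℚ.- ι b) (trans (ℤ.+-assoc a (ℤ.- b) b) (trans (cong (λ c → a ℤ.+ c) (ℤ.+-inverseˡ b)) (ℤ.+-identityʳ a))) ⟩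
  ι a ℚ.- ι b                       ∎
  where open ≡-Reasoning

ι-mono-< : ∀ {a b} → a ℤ.< b → ι a ℚ.< ι b
ι-mono-< {a} {b} a<b = ℚ.toℚᵘ-cancel-<
  (ℚᵘ.<-respˡ-≃ (ℚᵘ.≃-sym (toℚᵘ-ι a)) (ℚᵘ.<-respʳ-≃ (ℚᵘ.≃-sym (toℚᵘ-ι b))
    (ℚᵘ.*<* (subst₂ ℤ._<_ (sym (ℤ.*-identityʳ a)) (sym (ℤ.*-identityʳ b)) a<b))))

ι-mono-≤ : ∀ {a b} → a ℤ.≤ b → ι a ℚ.≤ ι b
ι-mono-≤ {a} {b} a≤b with ℤ.<-cmp a b
... | tri< a<b _ _   = ℚ.<⇒≤ (ι-mono-< a<b)
... | tri≈ _ refl _  = ℚ.≤-refl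
... | tri> _ _ b<a   = contradiction a≤b (ℤ.<⇒≱ b<a)

ι-cancel-< : ∀ {a b} → ι a ℚ.< ι b → a ℤ.< b
ι-cancel-< ιa<ιb = ℤ.≰⇒> λ b≤a → ℚ.<-irrefl refl (ℚ.<-≤-trans ιa<ιb (ι-mono-≤ b≤a))

ι-injective : ∀ {a b} → ι a ≡ ι b → a ≡ b
ι-injective {a} {b} eq with ℤ.<-cmp a b
... | tri< a<b _ _ = contradiction eq (ℚ.<⇒≢ (ι-mono-< a<b))
... | tri≈ _ a≡b _ = a≡b
... | tri> _ _ b<a = contradiction (sym eq) (ℚ.<⇒≢ (ι-mono-< b<a))

ι-sum : ∀ {n} (v : Vector ℤ n) → ι (sumℤ v) ≡ sumℚ (ι ∘ v)
ι-sum {zero}  v = refl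
ι-sum {suc n} v = trans (ι-+ (v zero) (sumℤ (tail v))) (cong (ι (v zero) ℚ.+_) (ι-sum (tail v)))

-- Real numbers with prescribed rational sequences

seq-sumᴿ : ∀ {n} (v : Vector ℝ n) i → seq (sumᴿ v) i ≡ sumℚ (λ k → seq (v k) i)
seq-sumᴿ {zero}  v i = refl
seq-sumᴿ {suc n} v i = cong (seq (v zero) i ℚ.+_) (seq-sumᴿ (tail v) i)

≗⇒≃ : ∀ x y → seq x ≗ seq y → x ≃ y
≗⇒≃ x y x≗y ε 0<ε = 0 , λ i _ → subst (ℚ._< ε) (sym (zero-distance i)) 0<ε
  where
  zero-distance : ∀ i → ℚ.∣ seq x i ℚ.- seq y i ∣ ≡ 0ℚ
  zero-distance i = cong ℚ.∣_∣ (trans (cong (ℚ._- seq y i) (x≗y i)) (ℚ.+-inverseʳ (seq y i)))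

≢⇒0<distance : ∀ {p q} → p ≢ q → 0ℚ ℚ.< ℚ.∣ p ℚ.- q ∣
≢⇒0<distance {p} {q} p≢q = ℚ.≰⇒> λ ∣p-q∣≤0 → p≢q (begin
  p                  ≡⟨ solve 2 (λ p q → p := p :- q :+ q) refl p q ⟩
  p ℚ.- q ℚ.+ q      ≡⟨ cong (ℚ._+ q) (ℚ.∣p∣≡0⇒p≡0 _ (ℚ.≤-antisym ∣p-q∣≤0 (ℚ.0≤∣p∣ _))) ⟩
  0ℚ ℚ.+ q           ≡⟨ ℚ.+-identityˡ q ⟩
  q                  ∎)
  where open ≡-Reasoning

-- If p and q differed, `_≃_` at ε = ∣p - q∣ would yield ∣p - q∣ < ∣p - q∣. Equality on ℚ is
-- decidable, so refuting p ≢ q is enough.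
≃-constant : ∀ x y {p q} → (∀ i → seq x i ≡ p) → (∀ i → seq y i ≡ q) → x ≃ y → p ≡ q
≃-constant x y {p} {q} x≡p y≡q x≃y = decidable-stable (p ℚ.≟ q) λ p≢q →
  let N , close = x≃y ℚ.∣ p ℚ.- q ∣ (≢⇒0<distance p≢q) in
  ℚ.<-irrefl (cong₂ (λ a b → ℚ.∣ a ℚ.- b ∣) (x≡p N) (y≡q N)) (close N ℕ.≤-refl)

0<fromℤ : ∀ {a} → 0ℤ ℤ.< a → 0ᴿ <ᴿ fromℤ a
0<fromℤ {a} 0<a = ι a , ι-mono-< 0<a , 0 , λ _ _ → ℚ.≤-reflexive (ℚ.+-identityˡ (ι a))

0<fromℤ⁻¹ : ∀ {a} → 0ᴿ <ᴿ fromℤ a → 0ℤ ℤ.< a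
0<fromℤ⁻¹ {a} (ε , 0<ε , N , bound) =
  ι-cancel-< (ℚ.<-≤-trans 0<ε (subst (ℚ._≤ ι a) (ℚ.+-identityˡ ε) (bound N ℕ.≤-refl)))

-- Sums over intervals and interval equations

-- The element i of `Fin m` stands for the gap between the markings `inject₁ i` and `suc i`, so the
-- gaps from j to k reach from the marking `inject₁ j` to the marking `suc k`.
lower upper : ∀ {m} {U : Subset m} → Consecutive U → Fin (suc m)
lower (j , _ , _) = inject₁ j
upper (_ , k , _) = suc k

spread : ∀ {m} {U : Subset m} → Vector ℚ (suc m) → Consecutive U → ℚ
spread X c = X (upper c) ℚ.- X (lower c)

-- The gaps before j together with those in U are, without overlap, the gaps up to k. Hence the sum
-- over U is a difference of two partial sums, and these telescope.
segment-sum : ∀ {m} {U : Subset m} (X : Vector ℚ (suc m)) (c : Consecutive U) →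
              sumℚ (λ i → if lookup U i then Δ X i else 0ℚ) ≡ spread X c
segment-sum {m} {U} X c@(j , k , j≤k , ∈U⇔) = begin
  S                                                 ≡⟨ solve 2 (λ s p → s := s :+ p :- p) refl S (partialSum (Δ X) (inject₁ j)) ⟩
  S ℚ.+ partialSum (Δ X) (inject₁ j) ℚ.- partialSum (Δ X) (inject₁ j)
    ≡⟨ cong (ℚ._- partialSum (Δ X) (inject₁ j)) (trans (sym (sumℚ-distrib-+ {n = m} _ _)) (sumℚ-cong pointwise)) ⟩
  partialSum (Δ X) (suc k) ℚ.- partialSum (Δ X) (inject₁ j)
    ≡⟨ cong₂ ℚ._-_ (Tℚ.partialSum-Δ X (suc k)) (Tℚ.partialSum-Δ X (inject₁ j)) ⟩
  (X (suc k) ℚ.- X zero) ℚ.- (X (inject₁ j) ℚ.- X zero)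
    ≡⟨ solve 3 (λ a b o → (a :- o) :- (b :- o) := a :- b) refl (X (suc k)) (X (inject₁ j)) (X zero) ⟩
  X (suc k) ℚ.- X (inject₁ j)                       ∎
  where
  open ≡-Reasoning
  S : ℚ
  S = sumℚ (λ i → if lookup U i then Δ X i else 0ℚ)

  inside : ∀ {i} → j ≤ᶠ i → i ≤ᶠ k → lookup U i ≡ true
  inside {i} j≤i i≤k = []=⇒lookup (Equivalence.from (∈U⇔ i) (j≤i , i≤k))

  outside : ∀ {i} → ¬ (j ≤ᶠ i × i ≤ᶠ k) → lookup U i ≡ false
  outside {i} ∉ = ¬-not λ eq → ∉ (Equivalence.to (∈U⇔ i) (lookup⇒[]= i U eq))

  below? : ∀ i (b : Fin (suc m)) → Dec (toℕ i ℕ.< toℕ b)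
  below? i b = toℕ i ℕ.<? toℕ b

  pointwise : ∀ i →
    (if lookup U i then Δ X i else 0ℚ) ℚ.+ (if does (below? i (inject₁ j)) then Δ X i else 0ℚ)
      ≡ (if does (below? i (suc k)) then Δ X i else 0ℚ)
  pointwise i with toℕ j ℕ.≤? toℕ i | toℕ i ℕ.≤? toℕ k
  ... | yes j≤i | yes i≤k
    rewrite inside {i} j≤i i≤k
          | dec-false (below? i (inject₁ j)) (ℕ.≤⇒≯ (ℕ.≤-trans (ℕ.≤-reflexive (Fin.toℕ-inject₁ j)) j≤i))
          | dec-true (below? i (suc k)) (s≤s i≤k) = ℚ.+-identityʳ _
  ... | yes j≤i | no i≰k
    rewrite outside {i} (i≰k ∘ proj₂)
          | dec-false (below? i (inject₁ j)) (ℕ.≤⇒≯ (ℕ.≤-trans (ℕ.≤-reflexive (Fin.toℕ-inject₁ j)) j≤i))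
          | dec-false (below? i (suc k)) (i≰k ∘ ℕ.s≤s⁻¹) = refl
  ... | no j≰i | yes i≤k
    rewrite outside {i} (j≰i ∘ proj₁)
          | dec-true (below? i (inject₁ j)) (ℕ.<-≤-trans (ℕ.≰⇒> j≰i) (ℕ.≤-reflexive (sym (Fin.toℕ-inject₁ j))))
          | dec-true (below? i (suc k)) (s≤s i≤k) = ℚ.+-identityˡ _
  ... | no j≰i | no i≰k = contradiction (ℕ.≤-trans (ℕ.<⇒≤ (ℕ.≰⇒> j≰i)) j≤k) i≰k

seq-sumOver : ∀ {m} {U : Subset m} (c : Consecutive U) (X : Vector ℚ (suc m)) (z : Vector ℝ m) i →
              (∀ j → seq (z j) i ≡ Δ X j) → seq (sumOver U z) i ≡ spread X c
seq-sumOver {m} {U} c X z i z≡ΔX = begin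
  seq (sumOver U z) i                                         ≡⟨ seq-sumᴿ {m} _ i ⟩
  sumℚ (λ j → seq (if lookup U j then z j else 0ᴿ) i)         ≡⟨ sumℚ-cong pointwise ⟩
  sumℚ (λ j → if lookup U j then Δ X j else 0ℚ)               ≡⟨ segment-sum X c ⟩
  spread X c                                                  ∎
  where
  open ≡-Reasoning
  pointwise : ∀ j → seq (if lookup U j then z j else 0ᴿ) i ≡ (if lookup U j then Δ X j else 0ℚ)
  pointwise j with lookup U j
  ... | true  = z≡ΔX j
  ... | false = refl

module _ {m h : ℕ} (E : IntervalEquation m h) where
  open IntervalEquation E

  leftSum rightSum : Vector ℝ m → ℝ
  leftSum  z = sumᴿ (λ (k : Fin ℓ) → sumOver (U (k ↑ˡ n)) z)
  rightSum z = sumᴿ (λ (k : Fin n) → sumOver (U (ℓ ↑ʳ k)) z)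

  leftSpread rightSpread : Vector ℚ (suc m) → ℚ
  leftSpread  X = sumℚ (λ (k : Fin ℓ) → spread X (consecutive (k ↑ˡ n)))
  rightSpread X = sumℚ (λ (k : Fin n) → spread X (consecutive (ℓ ↑ʳ k)))

  module _ (X : Vector ℚ (suc m)) (z : Vector ℝ m) (i : ℕ) (z≡ΔX : ∀ j → seq (z j) i ≡ Δ X j) where

    seq-left : seq (leftSum z) i ≡ leftSpread X
    seq-left = trans (seq-sumᴿ {ℓ} _ i)
      (sumℚ-cong {ℓ} λ k → seq-sumOver (consecutive (k ↑ˡ n)) X z i z≡ΔX)

    seq-right : seq (rightSum z) i ≡ rightSpread X
    seq-right = trans (seq-sumᴿ {n} _ i)
      (sumℚ-cong {n} λ k → seq-sumOver (consecutive (ℓ ↑ʳ k)) X z i z≡ΔX)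

  -- X varies with the sequence index i because the terms of an arbitrary real vector are, for each
  -- i, the differences of a different rational vector.
  spread≡⇒Satisfies : (X : ℕ → Vector ℚ (suc m)) (z : Vector ℝ m) →
    (∀ i j → seq (z j) i ≡ Δ (X i) j) →
    (∀ i → leftSpread (X i) ≡ rightSpread (X i)) → Satisfies E z
  spread≡⇒Satisfies X z z≡ΔX left≡right = ≗⇒≃ (leftSum z) (rightSum z) λ i →
    trans (seq-left (X i) z i (z≡ΔX i))
      (trans (left≡right i) (sym (seq-right (X i) z i (z≡ΔX i))))

  Satisfies⇒spread≡ : (X : Vector ℚ (suc m)) (z : Vector ℝ m) →
    (∀ i j → seq (z j) i ≡ Δ X j) → Satisfies E z → leftSpread X ≡ rightSpread X
  Satisfies⇒spread≡ X z z≡ΔX =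
    ≃-constant (leftSum z) (rightSum z) (λ i → seq-left X z i (z≡ΔX i))
      (λ i → seq-right X z i (z≡ΔX i))

  -- States without subtraction that left side minus right side of E, expanded in the markings, is
  -- the formal sum over p minus that over q. It ranges over all X because it is applied to the
  -- ruler, to test vectors and to the terms of real vectors.
  Balances : ∀ {g} → (p q : Vector (Fin (suc m)) g) → Set
  Balances p q = ∀ X → sumℚ (X ∘ p) ℚ.+ rightSpread X ≡ sumℚ (X ∘ q) ℚ.+ leftSpread X

  module _ {g} {p q : Vector (Fin (suc m)) g} (bal : Balances p q) (X : Vector ℚ (suc m)) where
    open AbelianGroupProperties ℚ.+-0-abelianGroup using (∙-cancelˡ; ∙-cancelʳ)

    spread≡⇒sum≡ : leftSpread X ≡ rightSpread X → sumℚ (X ∘ p) ≡ sumℚ (X ∘ q)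
    spread≡⇒sum≡ eq = ∙-cancelʳ (rightSpread X) _ _ (trans (bal X) (cong (sumℚ (X ∘ q) ℚ.+_) eq))

    sum≡⇒spread≡ : sumℚ (X ∘ p) ≡ sumℚ (X ∘ q) → leftSpread X ≡ rightSpread X
    sum≡⇒spread≡ eq = ∙-cancelˡ (sumℚ (X ∘ q)) _ _
      (trans (sym (bal X)) (cong (ℚ._+ rightSpread X) eq))

-- Sorted sequences of indices

Sorted : ∀ {k n} → Vector (Fin k) n → Set
Sorted r = Monotonic₁ _≤ᶠ_ _≤ᶠ_ r

∷-sorted : ∀ {k n} {a : Fin k} {r : Vector (Fin k) n} →
           (∀ i → a ≤ᶠ r i) → Sorted r → Sorted (a ∷ r)
∷-sorted a≤r r↗ {zero}  {zero}  _ = ℕ.≤-refl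
∷-sorted a≤r r↗ {zero}  {suc j} _ = a≤r j
∷-sorted a≤r r↗ {suc i} {suc j} (s≤s i≤j) = r↗ i≤j

-- The sum identity stands in for being a permutation. The last component, that common lower bounds
-- survive, strengthens the induction: it is what allows `r zero` to be put back in front of the
-- recursive result.
insert : ∀ {k n} (a : Fin k) (r : Vector (Fin k) n) → Sorted r →
         Σ[ r′ ∈ Vector (Fin k) (suc n) ] Sorted r′ ×
           (∀ (X : Fin k → ℚ) → sumℚ (X ∘ r′) ≡ X a ℚ.+ sumℚ (X ∘ r)) ×
           (∀ (b : Fin k) → b ≤ᶠ a → (∀ i → b ≤ᶠ r i) → ∀ i → b ≤ᶠ r′ i)
insert {n = zero} a r r↗ =
  a ∷ r , ∷-sorted (λ ()) r↗ , (λ X → refl) , λ { b b≤a b≤r zero → b≤a }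
insert {n = suc n} a r r↗ with ℕ.≤-total (toℕ a) (toℕ (r zero))
... | inj₁ a≤r₀ = a ∷ r , ∷-sorted (λ i → ℕ.≤-trans a≤r₀ (r↗ z≤n)) r↗ , (λ X → refl) ,
                  λ { b b≤a b≤r zero → b≤a ; b b≤a b≤r (suc i) → b≤r i }
... | inj₂ r₀≤a with insert a (tail r) (r↗ ∘ s≤s)
...   | r′ , r′↗ , sum-r′ , bound =
  r zero ∷ r′ , ∷-sorted (bound (r zero) r₀≤a (λ i → r↗ z≤n)) r′↗ ,
  (λ X → trans (cong (X (r zero) ℚ.+_) (sum-r′ X))
           (solve 3 (λ x y z → x :+ (y :+ z) := y :+ (x :+ z)) refl
             (X (r zero)) (X a) (sumℚ (X ∘ tail r)))) ,
  λ { b b≤a b≤r zero → b≤r zero ; b b≤a b≤r (suc i) → bound b b≤a (b≤r ∘ suc) i }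

insertAll : ∀ {k l n} (u : Vector (Fin k) l) (r : Vector (Fin k) n) → Sorted r →
            Σ[ r′ ∈ Vector (Fin k) (l ℕ.+ n) ] Sorted r′ ×
              (∀ (X : Fin k → ℚ) → sumℚ (X ∘ r′) ≡ sumℚ (X ∘ u) ℚ.+ sumℚ (X ∘ r))
insertAll {l = zero} u r r↗ = r , r↗ , λ X → sym (ℚ.+-identityˡ _)
insertAll {l = suc l} u r r↗ with insertAll (tail u) r r↗
... | r′ , r′↗ , sum-r′ with insert (u zero) r′ r′↗
...   | r″ , r″↗ , sum-r″ , _ = r″ , r″↗ , λ X →
  trans (sum-r″ X) (trans (cong (X (u zero) ℚ.+_) (sum-r′ X)) (sym (ℚ.+-assoc (X (u zero)) _ _)))

sum-mono-≤ : ∀ {n} {f g : Vector ℚ n} → (∀ i → f i ℚ.≤ g i) → sumℚ f ℚ.≤ sumℚ g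
sum-mono-≤ {zero}  f≤g = ℚ.≤-refl
sum-mono-≤ {suc n} f≤g = ℚ.+-mono-≤ (f≤g zero) (sum-mono-≤ (f≤g ∘ suc))

sum-mono-< : ∀ {n} {f g : Vector ℚ n} → (∀ i → f i ℚ.≤ g i) →
             ∀ k → f k ℚ.< g k → sumℚ f ℚ.< sumℚ g
sum-mono-< f≤g zero    fₖ<gₖ = ℚ.+-mono-<-≤ fₖ<gₖ (sum-mono-≤ (f≤g ∘ suc))
sum-mono-< f≤g (suc k) fₖ<gₖ = ℚ.+-mono-≤-< (f≤g zero) (sum-mono-< (f≤g ∘ suc) k fₖ<gₖ)

module _ {m h} {r s : Vector (Fin (suc m)) h} (r↗ : Sorted r) (s↗ : Sorted s) where

  -- For j ≤ k, f (r j) ≤ f (r k), which is the minimum of f; for j ≥ k, f (s j) ≥ f (s k), which is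
  -- the maximum. So f ∘ r ≤ f ∘ s everywhere, strictly at k.
  separated-sums : (f : Fin (suc m) → ℚ) → Monotonic₁ _≤ᶠ_ ℚ._≤_ f → ∀ k →
                   (∀ i → f (r k) ℚ.≤ f i) → (∀ i → f i ℚ.≤ f (s k)) →
                   f (r k) ℚ.< f (s k) → sumℚ (f ∘ r) ℚ.< sumℚ (f ∘ s)
  separated-sums f f↗ k min max = sum-mono-< f∘r≤f∘s k
    where
    f∘r≤f∘s : ∀ j → f (r j) ℚ.≤ f (s j)
    f∘r≤f∘s j with ℕ.≤-total (toℕ j) (toℕ k)
    ... | inj₁ j≤k = ℚ.≤-trans (f↗ (r↗ j≤k)) (min (s j))
    ... | inj₂ k≤j = ℚ.≤-trans (max (r j)) (f↗ (s↗ k≤j))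

  threshold-separates : ∀ k → r k <ᶠ s k → ∃[ X ] sumℚ (X ∘ r) ℚ.< sumℚ (X ∘ s)
  threshold-separates k rₖ<sₖ = X , separated-sums X X↗ k
    (λ i → subst (ℚ._≤ X i) (sym X[rₖ]≡0) (0≤X i))
    (λ i → subst (X i ℚ.≤_) (sym X[sₖ]≡1) (X≤1 i))
    (subst₂ ℚ._<_ (sym X[rₖ]≡0) (sym X[sₖ]≡1) 0<1)
    where
    above? : ∀ i → Dec (s k ≤ᶠ i)
    above? i = toℕ (s k) ℕ.≤? toℕ i

    X : Fin (suc m) → ℚ
    X i = if does (above? i) then 1ℚ else 0ℚ

    0<1 : 0ℚ ℚ.< 1ℚ
    0<1 = ι-mono-< {0ℤ} {+ 1} (ℤ.+<+ (s≤s z≤n))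

    0≤X : ∀ i → 0ℚ ℚ.≤ X i
    0≤X i with does (above? i)
    ... | true  = ℚ.<⇒≤ 0<1
    ... | false = ℚ.≤-refl

    X≤1 : ∀ i → X i ℚ.≤ 1ℚ
    X≤1 i with does (above? i)
    ... | true  = ℚ.≤-refl
    ... | false = ℚ.<⇒≤ 0<1

    X-above : ∀ {i} → s k ≤ᶠ i → X i ≡ 1ℚ
    X-above {i} sₖ≤i = cong (if_then 1ℚ else 0ℚ) (dec-true (above? i) sₖ≤i)

    X-below : ∀ {i} → ¬ (s k ≤ᶠ i) → X i ≡ 0ℚ
    X-below {i} sₖ≰i = cong (if_then 1ℚ else 0ℚ) (dec-false (above? i) sₖ≰i)

    X[rₖ]≡0 : X (r k) ≡ 0ℚ
    X[rₖ]≡0 = X-below (ℕ.<⇒≱ rₖ<sₖ)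

    X[sₖ]≡1 : X (s k) ≡ 1ℚ
    X[sₖ]≡1 = X-above ℕ.≤-refl

    X↗ : Monotonic₁ _≤ᶠ_ ℚ._≤_ X
    X↗ {i} {j} i≤j with toℕ (s k) ℕ.≤? toℕ i
    ... | yes sₖ≤i = subst (X i ℚ.≤_) (sym (X-above (ℕ.≤-trans sₖ≤i i≤j))) (X≤1 i)
    ... | no  sₖ≰i = subst (ℚ._≤ X j) (sym (X-below sₖ≰i)) (0≤X j)

-- Supplies the rational vector on which the equation built from r and s fails, which makes that
-- equation nondegenerate.
distinct-sorted : ∀ {m h} {r s : Vector (Fin (suc m)) h} → Sorted r → Sorted s →
                  ¬ (r ≗ s) → ∃[ X ] sumℚ (X ∘ r) ≢ sumℚ (X ∘ s)
distinct-sorted {h = h} {r} {s} r↗ s↗ r≇s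
  with Fin.¬∀⟶∃¬ h (λ k → r k ≡ s k) (λ k → r k Fin.≟ s k) r≇s
... | k , rₖ≢sₖ with Fin.<-cmp (r k) (s k)
...   | tri< rₖ<sₖ _ _ = let X , lt = threshold-separates r↗ s↗ k rₖ<sₖ in X , ℚ.<⇒≢ lt
...   | tri≈ _ rₖ≡sₖ _ = contradiction rₖ≡sₖ rₖ≢sₖ
...   | tri> _ _ sₖ<rₖ = let X , lt = threshold-separates s↗ r↗ k sₖ<rₖ in X , ℚ.<⇒≢ lt ∘ sym

-- From B_h-sets to avoiding lattice points

-- A left interval sends its upper endpoint to r and its lower one to s, a right interval the
-- reverse. Both receive the same e = h - h' copies of `zero`, which contribute equally to the two
-- sums.
sortedEndpoints : ∀ {m h} (E : IntervalEquation m h) →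
  Σ[ r ∈ Vector (Fin (suc m)) h ] Σ[ s ∈ Vector (Fin (suc m)) h ]
    Sorted r × Sorted s × Balances E r s
-- The sequences are built with length ℓ + (n + e), which equals h only propositionally.
sortedEndpoints {m} {h} E = subst
  (λ g → Σ[ r ∈ Vector (Fin (suc m)) g ] Σ[ s ∈ Vector (Fin (suc m)) g ]
           Sorted r × Sorted s × Balances E r s)
  length≡h (collect lowerʳ upperˡ .proj₁ , collect upperʳ lowerˡ .proj₁ ,
            collect lowerʳ upperˡ .proj₂ .proj₁ , collect upperʳ lowerˡ .proj₂ .proj₁ , balanced)
  where
  open IntervalEquation E
  e : ℕ
  e = h ℕ.∸ (ℓ ℕ.+ n)

  length≡h : ℓ ℕ.+ (n ℕ.+ e) ≡ h
  length≡h = trans (sym (ℕ.+-assoc ℓ n e)) (ℕ.m+[n∸m]≡n h'≤h)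

  lowerˡ upperˡ : Vector (Fin (suc m)) ℓ
  lowerˡ k = lower (consecutive (k ↑ˡ n))
  upperˡ k = upper (consecutive (k ↑ˡ n))

  lowerʳ upperʳ : Vector (Fin (suc m)) n
  lowerʳ k = lower (consecutive (ℓ ↑ʳ k))
  upperʳ k = upper (consecutive (ℓ ↑ʳ k))

  collect : (v : Vector (Fin (suc m)) n) (u : Vector (Fin (suc m)) ℓ) →
    Σ[ r ∈ Vector (Fin (suc m)) (ℓ ℕ.+ (n ℕ.+ e)) ] Sorted r ×
      (∀ X → sumℚ (X ∘ r) ≡ sumℚ (X ∘ u) ℚ.+ (sumℚ (X ∘ v) ℚ.+ sumℚ (X ∘ replicate e zero)))
  collect v u with insertAll v (replicate e zero) (λ _ → ℕ.≤-refl)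
  ... | r , r↗ , sum-r with insertAll u r r↗
  ...   | r′ , r′↗ , sum-r′ = r′ , r′↗ , λ X → trans (sum-r′ X) (cong (sumℚ (X ∘ u) ℚ.+_) (sum-r X))

  sum-spread : ∀ {l} (X : Vector ℚ (suc m)) (a b : Vector (Fin (suc m)) l) →
               sumℚ (λ k → X (b k) ℚ.- X (a k)) ℚ.+ sumℚ (X ∘ a) ≡ sumℚ (X ∘ b)
  sum-spread {l} X a b = trans (sym (sumℚ-distrib-+ {l} _ _))
    (sumℚ-cong {l} λ k → solve 2 (λ x y → x :- y :+ y := x) refl (X (b k)) (X (a k)))

  balanced : Balances E (collect lowerʳ upperˡ .proj₁) (collect upperʳ lowerˡ .proj₁)
  balanced X = begin
    sumℚ (X ∘ collect lowerʳ upperˡ .proj₁) ℚ.+ R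
      ≡⟨ cong (ℚ._+ R) (collect lowerʳ upperˡ .proj₂ .proj₂ X) ⟩
    (sumℚ (X ∘ upperˡ) ℚ.+ (sumℚ (X ∘ lowerʳ) ℚ.+ o)) ℚ.+ R
      ≡⟨ cong (λ a → (a ℚ.+ (sumℚ (X ∘ lowerʳ) ℚ.+ o)) ℚ.+ R) (sum-spread X lowerˡ upperˡ) ⟨
    ((L ℚ.+ sumℚ (X ∘ lowerˡ)) ℚ.+ (sumℚ (X ∘ lowerʳ) ℚ.+ o)) ℚ.+ R
      ≡⟨ solve 5 (λ L a b o R → ((L :+ a) :+ (b :+ o)) :+ R := (a :+ ((R :+ b) :+ o)) :+ L) refl
           L (sumℚ (X ∘ lowerˡ)) (sumℚ (X ∘ lowerʳ)) o R ⟩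
    (sumℚ (X ∘ lowerˡ) ℚ.+ ((R ℚ.+ sumℚ (X ∘ lowerʳ)) ℚ.+ o)) ℚ.+ L
      ≡⟨ cong (λ b → (sumℚ (X ∘ lowerˡ) ℚ.+ (b ℚ.+ o)) ℚ.+ L) (sum-spread X lowerʳ upperʳ) ⟩
    (sumℚ (X ∘ lowerˡ) ℚ.+ (sumℚ (X ∘ upperʳ) ℚ.+ o)) ℚ.+ L
      ≡⟨ cong (ℚ._+ L) (collect upperʳ lowerˡ .proj₂ .proj₂ X) ⟨
    sumℚ (X ∘ collect upperʳ lowerˡ .proj₁) ℚ.+ L ∎
    where
    open ≡-Reasoning
    L R o : ℚ
    L = leftSpread E X
    R = rightSpread E X
    o = sumℚ (X ∘ replicate e zero)

ι-differences : ∀ {m} (x : Vector ℤ (suc m)) (z : Vector ℤ m) → z ≗ differences x →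
                ∀ j → ι (z j) ≡ Δ (ι ∘ x) j
ι-differences x z z≗Δx j = trans (cong ι (z≗Δx j)) (ι-minus (x (suc j)) (x (inject₁ j)))

sum≡-ι : ∀ {m h} (x : Vector ℤ (suc m)) (r s : Vector (Fin (suc m)) h) →
         sumℤ (x ∘ r) ≡ sumℤ (x ∘ s) ⇔ sumℚ (ι ∘ x ∘ r) ≡ sumℚ (ι ∘ x ∘ s)
sum≡-ι x r s = mk⇔
  (λ eq → trans (sym (ι-sum (x ∘ r))) (trans (cong ι eq) (ι-sum (x ∘ s))))
  (λ eq → ι-injective (trans (ι-sum (x ∘ r)) (trans eq (sym (ι-sum (x ∘ s))))))

module _ {m h g : ℕ} (E : IntervalEquation m h) (r s : Vector (Fin (suc m)) g)
         (bal : Balances E r s) where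

  -- When r and s agree, the balance forces equal spreads for every X. For a real vector y, X is
  -- taken at each i to be the partial sums of the i-th terms of its coordinates.
  ≗⇒identity : r ≗ s → ∀ y → Satisfies E y
  ≗⇒identity r≗s y = spread≡⇒Satisfies E X y
    (λ i j → sym (Tℚ.Δ-partialSum (λ j → seq (y j) i) j))
    (λ i → sum≡⇒spread≡ E {p = r} {q = s} bal (X i) (sumℚ-cong (cong (X i) ∘ r≗s)))
    where
    X : ℕ → Vector ℚ (suc m)
    X i = partialSum (λ j → seq (y j) i)

  module _ (x : Vector ℤ (suc m)) (z : Vector ℤ m) (z≗Δx : z ≗ differences x) where

    Satisfies⇒sum≡ : Satisfies E (map fromℤ z) → sumℤ (x ∘ r) ≡ sumℤ (x ∘ s)
    Satisfies⇒sum≡ sat = Equivalence.from (sum≡-ι x r s)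
      (spread≡⇒sum≡ E {p = r} {q = s} bal (ι ∘ x)
        (Satisfies⇒spread≡ E (ι ∘ x) (map fromℤ z) (λ _ → ι-differences x z z≗Δx) sat))

    sum≡⇒Satisfies : sumℤ (x ∘ r) ≡ sumℤ (x ∘ s) → Satisfies E (map fromℤ z)
    sum≡⇒Satisfies eq = spread≡⇒Satisfies E (λ _ → ι ∘ x) (map fromℤ z)
      (λ _ → ι-differences x z z≗Δx)
      (λ _ → sum≡⇒spread≡ E {p = r} {q = s} bal (ι ∘ x) (Equivalence.to (sum≡-ι x r s) eq))

Bₕ⇒avoids : ∀ {m h} (x : Vector ℤ (suc m)) (z : Vector ℤ m) → z ≗ differences x →
            IsBₕSet h x → (E : IntervalEquation m h) → Nondegenerate E →
            ¬ Satisfies E (map fromℤ z)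
Bₕ⇒avoids {m} {h} x z z≗Δx bₕ E nondegenerate sat = conclude (sortedEndpoints E)
  where
  conclude : ¬ (Σ[ r ∈ Vector (Fin (suc m)) h ] Σ[ s ∈ Vector (Fin (suc m)) h ]
                  Sorted r × Sorted s × Balances E r s)
  conclude (r , s , r↗ , s↗ , bal) = bₕ r s r↗ s↗
    (λ r≗s → nondegenerate (≗⇒identity E r s bal r≗s))
    (Satisfies⇒sum≡ E r s bal x z z≗Δx sat)

-- From avoiding lattice points to B_h-sets

record Block (m : ℕ) : Set where
  field
    set         : Subset m
    consecutive : Consecutive set
    proper      : set ≢ ⊤

  width : Vector ℚ (suc m) → ℚ
  width X = spread X consecutive

open Block using (width)

-- The endpoints of the full interval [m], the one interval that is not proper.
Extremes : ∀ {m} → Fin (suc m) → Fin (suc m) → Set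
Extremes {m} a b = a ≡ zero × b ≡ fromℕ m

-- Since a < b, b is a successor `suc k` and a is not the last marking, so a is `inject₁ j` and the
-- interval consists of the gaps j to k. If it were everything, containing the first and the last
-- gap would force a and b to be extremes.
block : ∀ {m} (a b : Fin (suc m)) → a <ᶠ b → ¬ Extremes a b →
        Σ[ B ∈ Block m ] (∀ X → width B X ≡ X b ℚ.- X a)
block {suc m} a (suc k) a<b ¬extremes with view a
... | ‵fromℕ = contradiction a<b (ℕ.≤⇒≯ (Fin.≤fromℕ (suc k)))
... | ‵inject₁ j = record
  { set = U
  ; consecutive = j , k , j≤k , λ i → mk⇔ ∈U⇒ ⇒∈U
  ; proper = λ U≡⊤ → ¬extremes (first U≡⊤ , last U≡⊤)
  } , λ X → refl
  where
  j≤k : j ≤ᶠ k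
  j≤k = ℕ.≤-trans (ℕ.≤-reflexive (sym (Fin.toℕ-inject₁ j))) (ℕ.s≤s⁻¹ a<b)

  between? : ∀ i → Dec (j ≤ᶠ i × i ≤ᶠ k)
  between? i = (toℕ j ℕ.≤? toℕ i) ×-dec (toℕ i ℕ.≤? toℕ k)

  U : Subset (suc m)
  U = tabulate (does ∘ between?)

  does-sound : ∀ {P : Set} (P? : Dec P) → does P? ≡ true → P
  does-sound (yes p) _ = p

  ⇒∈U : ∀ {i} → j ≤ᶠ i × i ≤ᶠ k → i ∈ U
  ⇒∈U {i} p = lookup⇒[]= i U (trans (lookup∘tabulate (does ∘ between?) i) (dec-true (between? i) p))

  ∈U⇒ : ∀ {i} → i ∈ U → j ≤ᶠ i × i ≤ᶠ k
  ∈U⇒ {i} i∈U = does-sound (between? i)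
    (trans (sym (lookup∘tabulate (does ∘ between?) i)) ([]=⇒lookup i∈U))

  first : U ≡ ⊤ → inject₁ j ≡ zero
  first U≡⊤ = cong inject₁ (Fin.toℕ-injective (ℕ.n≤0⇒n≡0 (proj₁ (∈U⇒ {zero} (subst (zero ∈_) (sym U≡⊤) ∈⊤)))))

  last : U ≡ ⊤ → suc k ≡ fromℕ (suc m)
  last U≡⊤ = cong suc (Fin.≤-antisym (Fin.≤fromℕ k) (proj₂ (∈U⇒ {fromℕ m} (subst (fromℕ m ∈_) (sym U≡⊤) ∈⊤))))

-- An equation with its two sides still in separate vectors, so that `pairing` can prepend a block
-- to either one.
record Pairing {m h} (r s : Vector (Fin (suc m)) h) : Set where
  field
    ℓ n     : ℕ
    ℓ+n≤h   : ℓ ℕ.+ n ℕ.≤ h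
    L       : Vector (Block m) ℓ
    R       : Vector (Block m) n
    balance : ∀ X → sumℚ (X ∘ r) ℚ.+ sumℚ (λ k → width (R k) X)
                  ≡ sumℚ (X ∘ s) ℚ.+ sumℚ (λ k → width (L k) X)

-- Each index yields at most one block, hence ℓ + n ≤ h: none if the entries agree, a right block if
-- the entry of r is smaller, a left block if it is larger.
pairing : ∀ {m h} (r s : Vector (Fin (suc m)) h) →
          (∀ k → ¬ Extremes (r k) (s k)) → (∀ k → ¬ Extremes (s k) (r k)) → Pairing r s
pairing {h = zero} r s _ _ = record
  { ℓ = 0 ; n = 0 ; ℓ+n≤h = z≤n ; L = [] ; R = [] ; balance = λ _ → refl }
pairing {h = suc h} r s rs sr
  with pairing (tail r) (tail s) (rs ∘ suc) (sr ∘ suc) | Fin.<-cmp (r zero) (s zero)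
... | P | tri≈ _ r₀≡s₀ _ = record
  { ℓ = ℓ ; n = n ; ℓ+n≤h = ℕ.m≤n⇒m≤1+n ℓ+n≤h ; L = L ; R = R
  ; balance = λ X → trans (ℚ.+-assoc (X (r zero)) _ _)
      (trans (cong₂ ℚ._+_ (cong X r₀≡s₀) (balance X)) (sym (ℚ.+-assoc (X (s zero)) _ _)))
  }
  where open Pairing P
... | P | tri< r₀<s₀ _ _ = let B , width-B = block (r zero) (s zero) r₀<s₀ (rs zero) in record
  { ℓ = ℓ ; n = suc n
  ; ℓ+n≤h = ℕ.≤-trans (ℕ.≤-reflexive (ℕ.+-suc ℓ n)) (s≤s ℓ+n≤h)
  ; L = L ; R = B ∷ R
  ; balance = λ X → let x = X (r zero) ; y = X (s zero)
                        a = sumℚ (X ∘ tail r) ; b = sumℚ (λ k → width (R k) X)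
                        c = sumℚ (X ∘ tail s) ; d = sumℚ (λ k → width (L k) X) in begin
      (x ℚ.+ a) ℚ.+ (width B X ℚ.+ b)  ≡⟨ cong (λ w → (x ℚ.+ a) ℚ.+ (w ℚ.+ b)) (width-B X) ⟩
      (x ℚ.+ a) ℚ.+ (y ℚ.- x ℚ.+ b)    ≡⟨ solve 4 (λ x y a b → (x :+ a) :+ (y :- x :+ b) := y :+ (a :+ b)) refl x y a b ⟩
      y ℚ.+ (a ℚ.+ b)                  ≡⟨ cong (y ℚ.+_) (balance X) ⟩
      y ℚ.+ (c ℚ.+ d)                  ≡⟨ ℚ.+-assoc y c d ⟨
      (y ℚ.+ c) ℚ.+ d                  ∎
  }
  where
  open Pairing P
  open ≡-Reasoning
... | P | tri> _ _ s₀<r₀ = let B , width-B = block (s zero) (r zero) s₀<r₀ (sr zero) in record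
  { ℓ = suc ℓ ; n = n ; ℓ+n≤h = s≤s ℓ+n≤h ; L = B ∷ L ; R = R
  ; balance = λ X → let x = X (r zero) ; y = X (s zero)
                        a = sumℚ (X ∘ tail r) ; b = sumℚ (λ k → width (R k) X)
                        c = sumℚ (X ∘ tail s) ; d = sumℚ (λ k → width (L k) X) in begin
      (x ℚ.+ a) ℚ.+ b                  ≡⟨ ℚ.+-assoc x a b ⟩
      x ℚ.+ (a ℚ.+ b)                  ≡⟨ cong (x ℚ.+_) (balance X) ⟩
      x ℚ.+ (c ℚ.+ d)                  ≡⟨ solve 4 (λ x y c d → x :+ (c :+ d) := (y :+ c) :+ (x :- y :+ d)) refl x y c d ⟩
      (y ℚ.+ c) ℚ.+ (x ℚ.- y ℚ.+ d)    ≡⟨ cong (λ w → (y ℚ.+ c) ℚ.+ (w ℚ.+ d)) (width-B X) ⟨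
      (y ℚ.+ c) ℚ.+ (width B X ℚ.+ d)  ∎
  }
  where
  open Pairing P
  open ≡-Reasoning

pairing⇒equation : ∀ {m h} {r s : Vector (Fin (suc m)) h} → Pairing r s →
                   Σ[ E ∈ IntervalEquation m h ] Balances E r s
pairing⇒equation {r = r} {s} P = record
  { ℓ = ℓ ; n = n ; h'≤h = ℓ+n≤h
  ; U = Block.set ∘ (L ++ R)
  ; consecutive = λ k → Block.consecutive ((L ++ R) k)
  ; proper = λ k → Block.proper ((L ++ R) k)
  } , λ X → subst₂ (λ a b → sumℚ (X ∘ r) ℚ.+ a ≡ sumℚ (X ∘ s) ℚ.+ b)
        (sumℚ-cong λ k → cong (flip width X) (sym (lookup-++ʳ L R k)))
        (sumℚ-cong λ k → cong (flip width X) (sym (lookup-++ˡ L R k)))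
        (balance X)
  where open Pairing P

ruler-mono-≤ : ∀ {m t} {x : Vector ℤ (suc m)} → IsRuler t x → Monotonic₁ _≤ᶠ_ ℤ._≤_ x
ruler-mono-≤ {x = x} ruler {i} = <-weakInduction-startingFrom (λ j → x i ℤ.≤ x j) ℤ.≤-refl
  (λ j xᵢ≤xⱼ → ℤ.≤-trans xᵢ≤xⱼ (ℤ.<⇒≤ (IsRuler.increasing ruler j)))

module _ {m h t : ℕ} (1≤t : 1 ≤ t) {x : Vector ℤ (suc m)} (ruler : IsRuler t x) where
  open IsRuler ruler

  -- The ruler itself is monotone, minimal at the first marking and maximal at the last, so
  -- `separated-sums` would make the two sums differ.
  ¬extremes : {r s : Vector (Fin (suc m)) h} → Sorted r → Sorted s →
              sumℤ (x ∘ r) ≡ sumℤ (x ∘ s) → ∀ k → ¬ Extremes (r k) (s k)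
  ¬extremes {r} {s} r↗ s↗ eq k (rₖ≡0 , sₖ≡m) =
    ℚ.<⇒≢ strict (Equivalence.to (sum≡-ι x r s) eq)
    where
    x↗ : Monotonic₁ _≤ᶠ_ ℤ._≤_ x
    x↗ = ruler-mono-≤ ruler

    strict : sumℚ (ι ∘ x ∘ r) ℚ.< sumℚ (ι ∘ x ∘ s)
    strict = separated-sums r↗ s↗ (ι ∘ x) (ι-mono-≤ ∘ x↗) k
      (λ i → ι-mono-≤ (subst (λ a → x a ℤ.≤ x i) (sym rₖ≡0) (x↗ z≤n)))
      (λ i → ι-mono-≤ (subst (λ a → x i ℤ.≤ x a) (sym sₖ≡m) (x↗ (Fin.≤fromℕ i))))
      -- Strictness at k is the inequality 0 < t between the two end markings.
      (ι-mono-< (subst₂ ℤ._<_ (sym (trans (cong x rₖ≡0) starts)) (sym (trans (cong x sₖ≡m) ends))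
        (ℤ.+<+ 1≤t)))

  avoids⇒Bₕ : (z : Vector ℤ m) → z ≗ differences x →
              ((E : IntervalEquation m h) → Nondegenerate E → ¬ Satisfies E (map fromℤ z)) →
              IsBₕSet h x
  avoids⇒Bₕ z z≗Δx avoids r s r↗ s↗ r≇s eq =
    avoids E nondegenerate (sum≡⇒Satisfies E r s bal x z z≗Δx eq)
    where
    paired : Σ[ E ∈ IntervalEquation m h ] Balances E r s
    paired = pairing⇒equation (pairing r s (¬extremes r↗ s↗ eq) (¬extremes s↗ r↗ (sym eq)))

    E : IntervalEquation m h
    E = proj₁ paired

    bal : Balances E r s
    bal = proj₂ paired

    nondegenerate : Nondegenerate E
    -- An identity would hold at the constant real vector with differences Δ X, and the balance
    -- would then equate the two sums that X separates.
    nondegenerate identity = let X , sums≢ = distinct-sorted r↗ s↗ r≇s in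
      sums≢ (spread≡⇒sum≡ E {p = r} {q = s} bal X
        (Satisfies⇒spread≡ E X (fromℚ ∘ Δ X) (λ _ _ → refl) (identity (fromℚ ∘ Δ X))))

-- Rulers and lattice points in the interior of the dilated simplex.

seq-sum-fromℤ : ∀ {m} (z : Vector ℤ m) i → seq (sumᴿ (map fromℤ z)) i ≡ ι (sumℤ z)
seq-sum-fromℤ z i = trans (seq-sumᴿ (map fromℤ z) i) (sym (ι-sum z))

i<j⇒0<j-i : ∀ {i j} → i ℤ.< j → 0ℤ ℤ.< j ℤ.- i
i<j⇒0<j-i {i} {j} i<j = subst (ℤ._< j ℤ.- i) (ℤ.+-inverseʳ i) (ℤ.+-monoˡ-< (ℤ.- i) i<j)

0<j-i⇒i<j : ∀ {i j} → 0ℤ ℤ.< j ℤ.- i → i ℤ.< j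
0<j-i⇒i<j {i} {j} 0<j-i = ℤ.≰⇒> λ j≤i → ℤ.<⇒≱ 0<j-i
  (subst (j ℤ.- i ℤ.≤_) (ℤ.+-inverseʳ i) (ℤ.+-monoˡ-≤ (ℤ.- i) j≤i))

ruler⇒interior : ∀ {m t} {x : Vector ℤ (suc m)} → IsRuler t x →
                 InteriorOfDilatedSimplex (fromℤ (+ t)) (map fromℤ (differences x))
ruler⇒interior {m} {t} {x} ruler =
  (λ i → 0<fromℤ (i<j⇒0<j-i (increasing i))) ,
  ≗⇒≃ (sumᴿ (map fromℤ (differences x))) (fromℤ (+ t)) (λ i → trans (seq-sum-fromℤ (differences x) i) (cong ι total))
  where
  open IsRuler ruler
  open ≡-Reasoning
  total : sumℤ (differences x) ≡ + t
  total = begin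
    sumℤ (differences x)                         ≡⟨ Tℤ.partialSum-last (differences x) ⟨
    Tℤ.partialSum (differences x) (fromℕ m)      ≡⟨ Tℤ.partialSum-Δ x (fromℕ m) ⟩
    x (fromℕ m) ℤ.- x zero                       ≡⟨ cong₂ ℤ._-_ ends starts ⟩
    + t ℤ.- 0ℤ                                   ≡⟨ ℤ.+-identityʳ (+ t) ⟩
    + t                                          ∎

interior⇒ruler : ∀ {m t} {z : Vector ℤ m} →
                 InteriorOfDilatedSimplex (fromℤ (+ t)) (map fromℤ z) → IsRuler t (Tℤ.partialSum z)
interior⇒ruler {m} {t} {z} (positive , total) = record
  { starts = Tℤ.partialSum-zero z
  ; increasing = λ i → 0<j-i⇒i<j
      (subst (0ℤ ℤ.<_) (sym (Tℤ.Δ-partialSum z i)) (0<fromℤ⁻¹ (positive i)))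
  ; ends = trans (Tℤ.partialSum-last z)
      -- Both sides are constant sequences of integers, so their equality as reals is equality in ℤ.
      (ι-injective (≃-constant (sumᴿ (map fromℤ z)) (fromℤ (+ t)) (seq-sum-fromℤ z) (λ _ → refl) total))
  }

proposition3p3 : (m h t : ℕ) → 1 ≤ m → 2 ≤ h → 1 ≤ t →
    Σ[ φ ∈ Bijection (BₕRulers m h t) (AvoidingLatticePoints m h t) ]
    ((x : BₕRuler m h t) → proj₁ (Bijection.to φ x) ≗ differences (proj₁ x))
proposition3p3 m h t _ _ 1≤t = record
  { to = λ (x , ruler , bₕ) →
      differences x , ruler⇒interior ruler , Bₕ⇒avoids x (differences x) (λ _ → refl) bₕ
  ; cong = λ x≗y i → cong₂ ℤ._-_ (x≗y (suc i)) (x≗y (inject₁ i))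
  ; bijective =
      (λ {(x , ruler-x , _)} {(y , ruler-y , _)} →
        -- All rulers start at 0, so their differences determine them.
        Tℤ.Δ-injective x y (trans (starts ruler-x) (sym (starts ruler-y)))) ,
      λ (z , interior , avoids) →
        (Tℤ.partialSum z , interior⇒ruler interior ,
          avoids⇒Bₕ 1≤t (interior⇒ruler interior) z (sym ∘ Tℤ.Δ-partialSum z) avoids) ,
        -- Setoid surjectivity asks that every ruler pointwise equal to the chosen preimage map to
        -- z.
        λ x≗Σz i → trans (cong₂ ℤ._-_ (x≗Σz (suc i)) (x≗Σz (inject₁ i))) (Tℤ.Δ-partialSum z i)
  } , λ _ _ → refl
  where open IsRuler
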